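{- A well-founded order $P$ is up-regular if and only if for every trunk $T$ of $P$ such that the set of levels of $P$ meeting $T$ has a largest element $h$, the set $T\cup L_h$ is a trunk, where $L_h=\{x:\mathrm{Level}(x)=h\}$. In particular, in an up-regular well-founded order, every trunk that is maximal under inclusion and meets a highest level $L_h$ contains $L_h$.
   Context: Orders are partial orders; $x\sim y$ means $x\ne y$ and $x,y$ incomparable. For a well-founded order $P$, $\mathrm{Level}(x)=\sup\{\mathrm{Level}(y)+1:y<x\}$. An element $x$ is up-regular if for all $y,z$ with $\mathrm{Level}(x)<\mathrm{Level}(y)=\mathrm{Level}(z)$ we have $x<y\iff x<z$; $P$ is up-regular if all its elements are. A trunk of $P$ is a subset $T$ such that for pairwise distinct $x,y,z\in T$, $x\sim y$ and $y\sim z$ imply $x\sim z$. -}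

module Defs where

open import Level using (Level; _⊔_; suc)
open import Data.Product.Base using (Σ; ∃; _×_; _,_)
open import Data.Unit.Polymorphic.Base using (⊤)
open import Function.Bundles using (_⇔_)
open import Induction.WellFounded using (Acc; acc; WellFounded)
open import Relation.Binary.Bundles using (Poset)
open import Relation.Binary.Core using (Rel)
open import Relation.Binary.Definitions using (_Respects_)
open import Relation.Unary using (Pred; _∈_; _⊆_; _≬_)
import Relation.Binary.Properties.Poset as PosetProperties

-- Ordinals as well-founded trees: the tree  lsup A f  denotes the least
-- ordinal strictly above every  f a.  Distinct trees may denote the same
-- ordinal, so equality of ordinals is _≈ᵒ_, never _≡_.

data Ord (ℓ : Level) : Set (suc ℓ) where
  lsup : (A : Set ℓ) → (A → Ord ℓ) → Ord ℓ

infix 4 _≤ᵒ_ _<ᵒ_ _≈ᵒ_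

_≤ᵒ_ _<ᵒ_ _≈ᵒ_ : ∀ {ℓ} → Rel (Ord ℓ) ℓ
lsup A f ≤ᵒ β = ∀ a → f a <ᵒ β
α <ᵒ lsup B g = ∃ λ b → α ≤ᵒ g b
α ≈ᵒ β = α ≤ᵒ β × β ≤ᵒ α

sucᵒ : ∀ {ℓ} → Ord ℓ → Ord ℓ
sucᵒ α = lsup ⊤ λ _ → α

Branch : ∀ {ℓ} → Ord ℓ → Set ℓ
Branch (lsup A f) = A

subtree : ∀ {ℓ} (α : Ord ℓ) → Branch α → Ord ℓ
subtree (lsup A f) = f

-- The supremum of a family: its subtrees are all those of the members.

⨆ : ∀ {ℓ} {I : Set ℓ} → (I → Ord ℓ) → Ord ℓ
⨆ {I = I} f = lsup (Σ I λ i → Branch (f i)) λ (i , b) → subtree (f i) b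

module Order {c ℓ₁ ℓ₂} (P : Poset c ℓ₁ ℓ₂) where

  open Poset P using (Carrier; _≈_; _≉_; _≰_)
  open PosetProperties P public using (_<_)

  infix 4 _∼_

  _∼_ : Rel Carrier (ℓ₁ ⊔ ℓ₂)
  x ∼ y = x ≉ y × x ≰ y × y ≰ x

  -- A subset of the underlying set is a predicate closed under _≈_.

  record IsTrunk {t} (T : Pred Carrier t) : Set (c ⊔ ℓ₁ ⊔ ℓ₂ ⊔ t) where
    field
      resp    : T Respects _≈_
      ∼-trans : ∀ {x y z} → x ∈ T → y ∈ T → z ∈ T →
                x ≉ y → y ≉ z → x ≉ z → x ∼ y → y ∼ z → x ∼ z

  record IsMaximalTrunk {t} (T : Pred Carrier t) : Set (c ⊔ ℓ₁ ⊔ ℓ₂ ⊔ suc t) where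
    field
      isTrunk : IsTrunk T
      maximal : (S : Pred Carrier t) → IsTrunk S → T ⊆ S → S ⊆ T

module WellFoundedOrder {c ℓ₁ ℓ₂} (P : Poset c ℓ₁ ℓ₂)
                        (wf : WellFounded (PosetProperties._<_ P)) where

  open Poset P using (Carrier)
  open Order P public

  levelAcc : (x : Carrier) → Acc _<_ x → Ord (c ⊔ ℓ₁ ⊔ ℓ₂)
  levelAcc x (acc rs) =
    ⨆ {I = ∃ λ y → y < x} λ (y , y<x) → sucᵒ (levelAcc y (rs y<x))

  level : Carrier → Ord (c ⊔ ℓ₁ ⊔ ℓ₂)
  level x = levelAcc x (wf x)

  L : Ord (c ⊔ ℓ₁ ⊔ ℓ₂) → Pred Carrier (c ⊔ ℓ₁ ⊔ ℓ₂)
  L h x = level x ≈ᵒ h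

  UpRegularElement : Pred Carrier (c ⊔ ℓ₁ ⊔ ℓ₂)
  UpRegularElement x =
    ∀ y z → level x <ᵒ level y → level y ≈ᵒ level z → x < y ⇔ x < z

  UpRegular : Set (c ⊔ ℓ₁ ⊔ ℓ₂)
  UpRegular = ∀ x → UpRegularElement x

  -- The set of levels of P meeting T has largest element h.

  IsHighestLevel : ∀ {t} → Pred Carrier t → Ord (c ⊔ ℓ₁ ⊔ ℓ₂) →
                   Set (suc (c ⊔ ℓ₁ ⊔ ℓ₂) ⊔ t)
  IsHighestLevel T h = L h ≬ T × (∀ k → L k ≬ T → k ≤ᵒ h)

{-# OPTIONS --safe #-}
-- Elements of equal level are equal or incomparable.  In an up-regular order,
-- an element x below level h cannot distinguish the elements of L_h: it is
-- incomparable to all of them or to none.  Hence, given a trunk T meeting L_h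
-- in w, any element of L_h occurring in an instance of transitivity can be
-- replaced by w.  Conversely, if x < y and z has the level of y, then {x , y}
-- is a trunk; when its union with the level of y is a trunk too, z ∼ y rules
-- out x ∼ z, leaving only x < z.
module Submission where

open import Defs
open import Level using (_⊔_; Lift; lift; lower)
open import Axiom.ExcludedMiddle using (ExcludedMiddle)
open import Data.Product.Base using (_×_; _,_; proj₁; proj₂; swap)
open import Data.Sum.Base using (_⊎_; inj₁; inj₂)
open import Function.Bundles using (_⇔_; mk⇔; Equivalence)
open import Induction.WellFounded using (Acc; acc; WellFounded)
open import Relation.Binary.Bundles using (Poset)
open import Relation.Binary.Definitions using (Decidable; _Respects_)
open import Relation.Nullary.Decidable using (yes; no; map′)
open import Relation.Nullary.Negation using (¬_; contradiction)
open import Relation.Unary using (Pred; _∈_; _∪_; _⊆_)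
import Relation.Binary.Construct.NonStrictToStrict as ToStrict

-- Order on tree ordinals.

≤ᵒ-refl : ∀ {ℓ} (α : Ord ℓ) → α ≤ᵒ α
≤ᵒ-refl (lsup A f) a = a , ≤ᵒ-refl (f a)

≤ᵒ-trans : ∀ {ℓ} (α β γ : Ord ℓ) → α ≤ᵒ β → β ≤ᵒ γ → α ≤ᵒ γ
≤ᵒ-trans (lsup A f) (lsup B g) (lsup C h) α≤β β≤γ a
  with b , fa≤gb ← α≤β a
  with c , gb≤hc ← β≤γ b = c , ≤ᵒ-trans (f a) (g b) (h c) fa≤gb gb≤hc

≤ᵒ-<ᵒ-trans : ∀ {ℓ} (α β γ : Ord ℓ) → α ≤ᵒ β → β <ᵒ γ → α <ᵒ γ
≤ᵒ-<ᵒ-trans α β (lsup C h) α≤β (c , β≤hc) = c , ≤ᵒ-trans α β (h c) α≤β β≤hc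

<ᵒ-≤ᵒ-trans : ∀ {ℓ} (α β γ : Ord ℓ) → α <ᵒ β → β ≤ᵒ γ → α <ᵒ γ
<ᵒ-≤ᵒ-trans α (lsup B g) γ (b , α≤gb) β≤γ = ≤ᵒ-<ᵒ-trans α (g b) γ α≤gb (β≤γ b)

-- If `α ≤ᵒ f a`, then the subtree `f a` is itself strictly below `f a`, so a counterexample
-- descends forever.
<ᵒ-irrefl : ∀ {ℓ} (α : Ord ℓ) → ¬ α <ᵒ α
<ᵒ-irrefl (lsup A f) (a , α≤fa) = <ᵒ-irrefl (f a) (α≤fa a)

<ᵒ⇒≱ᵒ : ∀ {ℓ} (α β : Ord ℓ) → α <ᵒ β → ¬ β ≤ᵒ α
<ᵒ⇒≱ᵒ α β α<β β≤α = <ᵒ-irrefl α (<ᵒ-≤ᵒ-trans α β α α<β β≤α)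

≈ᵒ-trans : ∀ {ℓ} (α β γ : Ord ℓ) → α ≈ᵒ β → β ≈ᵒ γ → α ≈ᵒ γ
≈ᵒ-trans α β γ (α≤β , β≤α) (β≤γ , γ≤β) =
  ≤ᵒ-trans α β γ α≤β β≤γ , ≤ᵒ-trans γ β α γ≤β β≤α

-- If `β <ᵒ α` fails, no subtree `f a` is above `β`. The induction hypothesis, with the two sides
-- exchanged, then puts every `f a` strictly below `β`.
≤ᵒ⊎>ᵒ : ∀ {ℓ} → ExcludedMiddle ℓ → (α β : Ord ℓ) → α ≤ᵒ β ⊎ β <ᵒ α
≤ᵒ⊎>ᵒ em (lsup A f) β with em {β <ᵒ lsup A f}
... | yes β<α = inj₂ β<α
... | no  β≮α = inj₁ below
  where
  below : ∀ a → f a <ᵒ β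
  below a with ≤ᵒ⊎>ᵒ em β (f a)
  ... | inj₁ β≤fa = contradiction (a , β≤fa) β≮α
  ... | inj₂ fa<β = fa<β

-- Levels, incomparability and two-element trunks.

module Levels {c ℓ₁ ℓ₂} (P : Poset c ℓ₁ ℓ₂) (wf : WellFounded (Order._<_ P)) where

  open Poset P using (Carrier; _≈_; _≤_; refl; reflexive; trans; antisym; ≤-respʳ-≈; module Eq)
  open WellFoundedOrder P wf

  <-≤-trans : ∀ {x y z} → x < y → y ≤ z → x < z
  <-≤-trans = ToStrict.<-≤-trans _≈_ _≤_ Eq.sym trans antisym ≤-respʳ-≈

  ∼-sym : ∀ {x y} → x ∼ y → y ∼ x
  ∼-sym (x≉y , x≰y , y≰x) = (λ y≈x → x≉y (Eq.sym y≈x)) , y≰x , x≰y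

  -- Whatever lies below `x` lies below `y`, so it contributes to both suprema. The accessibility
  -- proofs are arbitrary because the recursion compares one element under two of them; that is the
  -- instance `refl`.
  levelAcc-mono-≤ : ∀ {x y} → x ≤ y → (p : Acc _<_ x) (q : Acc _<_ y) →
                    levelAcc x p ≤ᵒ levelAcc y q
  levelAcc-mono-≤ x≤y (acc rs) (acc ss) ((z , z<x) , _) =
    ((z , <-≤-trans z<x x≤y) , _) , levelAcc-mono-≤ refl (rs z<x) (ss (<-≤-trans z<x x≤y))

  levelAcc-mono-< : ∀ {x y} → x < y → (p : Acc _<_ x) (q : Acc _<_ y) →
                    levelAcc x p <ᵒ levelAcc y q
  levelAcc-mono-< {x} x<y p (acc ss) = ((x , x<y) , _) , levelAcc-mono-≤ refl p (ss x<y)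

  level-mono-≤ : ∀ {x y} → x ≤ y → level x ≤ᵒ level y
  level-mono-≤ {x} {y} x≤y = levelAcc-mono-≤ x≤y (wf x) (wf y)

  level-mono-< : ∀ {x y} → x < y → level x <ᵒ level y
  level-mono-< {x} {y} x<y = levelAcc-mono-< x<y (wf x) (wf y)

  level-cong : ∀ {x y} → x ≈ y → level x ≈ᵒ level y
  level-cong x≈y = level-mono-≤ (reflexive x≈y) , level-mono-≤ (reflexive (Eq.sym x≈y))

  L-resp-≈ : ∀ h → L h Respects _≈_
  L-resp-≈ h {x} {y} x≈y = ≈ᵒ-trans (level y) (level x) h (level-cong (Eq.sym x≈y))

  level-<⇒≱ : ∀ {x y} → level x <ᵒ level y → ¬ y ≤ x
  level-<⇒≱ {x} {y} lx<ly y≤x = <ᵒ⇒≱ᵒ (level x) (level y) lx<ly (level-mono-≤ y≤x)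

  level-<⇒≉ : ∀ {x y} → level x <ᵒ level y → ¬ x ≈ y
  level-<⇒≉ lx<ly x≈y = level-<⇒≱ lx<ly (reflexive (Eq.sym x≈y))

  level-<∧≰⇒∼ : ∀ {x y} → level x <ᵒ level y → ¬ x ≤ y → x ∼ y
  level-<∧≰⇒∼ lx<ly x≰y = level-<⇒≉ lx<ly , x≰y , level-<⇒≱ lx<ly

  level-≈∧≉⇒∼ : ∀ {x y} → level x ≈ᵒ level y → ¬ x ≈ y → x ∼ y
  level-≈∧≉⇒∼ {x} {y} (lx≤ly , ly≤lx) x≉y =
      x≉y
    , (λ x≤y → <ᵒ⇒≱ᵒ (level x) (level y) (level-mono-< (x≤y , x≉y)) ly≤lx)
    , (λ y≤x → <ᵒ⇒≱ᵒ (level y) (level x) (level-mono-< (y≤x , λ y≈x → x≉y (Eq.sym y≈x))) lx≤ly)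

  L-≈ : ∀ {h x y} → x ∈ L h → y ∈ L h → level x ≈ᵒ level y
  L-≈ {h} {x} {y} x∈L y∈L = ≈ᵒ-trans (level x) h (level y) x∈L (swap y∈L)

  -- The levels already exclude `z ≤ x`; were `x ≤ z`, up-regularity would carry `x < z` over to
  -- `x < y`.
  upRegular-∼ : UpRegular → ∀ {h x y z} → level x <ᵒ h → y ∈ L h → z ∈ L h → x ∼ y → x ∼ z
  upRegular-∼ upReg {h} {x} {y} {z} lx<h y∈L z∈L (_ , x≰y , _) =
    level-<∧≰⇒∼ lx<lz λ x≤z →
      x≰y (proj₁ (Equivalence.to (upReg x z y lx<lz (L-≈ z∈L y∈L)) (x≤z , level-<⇒≉ lx<lz)))
    where
    lx<lz : level x <ᵒ level z
    lx<lz = <ᵒ-≤ᵒ-trans (level x) h (level z) lx<h (proj₂ z∈L)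

  -- The lift places the pair in the universe of the trunks quantified over in
  -- `TrunksAbsorbTopLevel`.
  ⟪_,_⟫ : Carrier → Carrier → Pred Carrier (c ⊔ ℓ₁ ⊔ ℓ₂)
  ⟪ x , y ⟫ a = Lift (c ⊔ ℓ₁ ⊔ ℓ₂) (a ≈ x ⊎ a ≈ y)

  -- Pigeonhole: of three members, two are equivalent to the same one of `x` and `y`, against
  -- distinctness.
  pair-isTrunk : ∀ x y → IsTrunk ⟪ x , y ⟫
  pair-isTrunk x y = record { resp = resp′ ; ∼-trans = trans′ }
    where
    resp′ : ⟪ x , y ⟫ Respects _≈_
    resp′ a≈b (lift (inj₁ a≈x)) = lift (inj₁ (Eq.trans (Eq.sym a≈b) a≈x))
    resp′ a≈b (lift (inj₂ a≈y)) = lift (inj₂ (Eq.trans (Eq.sym a≈b) a≈y))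

    join : ∀ {a b d} → a ≈ d → b ≈ d → a ≈ b
    join a≈d b≈d = Eq.trans a≈d (Eq.sym b≈d)

    trans′ : ∀ {p q r} → p ∈ ⟪ x , y ⟫ → q ∈ ⟪ x , y ⟫ → r ∈ ⟪ x , y ⟫ →
             ¬ p ≈ q → ¬ q ≈ r → ¬ p ≈ r → p ∼ q → q ∼ r → p ∼ r
    trans′ (lift (inj₁ p)) (lift (inj₁ q)) _ p≉q _ _ _ _ = contradiction (join p q) p≉q
    trans′ (lift (inj₂ p)) (lift (inj₂ q)) _ p≉q _ _ _ _ = contradiction (join p q) p≉q
    trans′ (lift (inj₁ p)) _ (lift (inj₁ r)) _ _ p≉r _ _ = contradiction (join p r) p≉r
    trans′ (lift (inj₂ p)) _ (lift (inj₂ r)) _ _ p≉r _ _ = contradiction (join p r) p≉r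
    trans′ _ (lift (inj₁ q)) (lift (inj₁ r)) _ q≉r _ _ _ = contradiction (join q r) q≉r
    trans′ _ (lift (inj₂ q)) (lift (inj₂ r)) _ q≉r _ _ _ = contradiction (join q r) q≉r

  pair-highestLevel : ∀ {x y} → x < y → IsHighestLevel ⟪ x , y ⟫ (level y)
  pair-highestLevel {x} {y} x<y =
    (y , (≤ᵒ-refl (level y) , ≤ᵒ-refl (level y)) , lift (inj₂ Eq.refl)) , highest
    where
    member-≤ : ∀ {a} → a ∈ ⟪ x , y ⟫ → a ≤ y
    member-≤ (lift (inj₁ a≈x)) = trans (reflexive a≈x) (proj₁ x<y)
    member-≤ (lift (inj₂ a≈y)) = reflexive a≈y

    highest : ∀ k → _ → k ≤ᵒ level y
    highest k (a , (_ , k≤la) , a∈) = ≤ᵒ-trans k (level a) (level y) k≤la (level-mono-≤ (member-≤ a∈))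

  TrunksAbsorbTopLevel : Set _
  TrunksAbsorbTopLevel = (T : Pred Carrier (c ⊔ ℓ₁ ⊔ ℓ₂)) → IsTrunk T →
                         ∀ h → IsHighestLevel T h → IsTrunk (T ∪ L h)

  -- Up-regularity and absorption of the top level.

  module Classical (em : ExcludedMiddle (c ⊔ ℓ₁ ⊔ ℓ₂)) where

    _≤?_ : Decidable _≤_
    x ≤? y = map′ lower lift (em {Lift (c ⊔ ℓ₁ ⊔ ℓ₂) (x ≤ y)})

    _≈?_ : Decidable _≈_
    x ≈? y = map′ lower lift (em {Lift (c ⊔ ℓ₁ ⊔ ℓ₂) (x ≈ y)})

    upRegular⇒absorb : UpRegular → TrunksAbsorbTopLevel
    upRegular⇒absorb upReg T trunk h ((w , w∈L , w∈T) , highest) =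
      record { resp = resp′ ; ∼-trans = λ x∈ y∈ z∈ _ _ x≉z →
                 trans′ (position x∈) (position y∈) (position z∈) x≉z }
      where
      open IsTrunk trunk

      resp′ : (T ∪ L h) Respects _≈_
      resp′ x≈y (inj₁ x∈T) = inj₁ (resp x≈y x∈T)
      resp′ x≈y (inj₂ x∈L) = inj₂ (L-resp-≈ h x≈y x∈L)

      Below : Pred Carrier _
      Below x = x ∈ T × level x <ᵒ h

      -- By `highest`, a member of `T` not strictly below `h` has level exactly `h`, so it is
      -- classed with `L h`.
      position : ∀ {x} → x ∈ T ∪ L h → Below x ⊎ x ∈ L h
      position (inj₂ x∈L) = inj₂ x∈L
      position {x} (inj₁ x∈T) with ≤ᵒ⊎>ᵒ em h (level x)
      ... | inj₁ h≤lx =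
        inj₂ (highest (level x) (x , (≤ᵒ-refl (level x) , ≤ᵒ-refl (level x)) , x∈T) , h≤lx)
      ... | inj₂ lx<h = inj₁ (x∈T , lx<h)

      -- `toW` moves an incomparability onto `w`, where the trunk `T` applies; `fromW` moves the
      -- result back to an element of `L h`.
      toW : ∀ {x y} → Below x → y ∈ L h → x ∼ y → x ∼ w
      toW (_ , lx<h) y∈L = upRegular-∼ upReg lx<h y∈L w∈L

      fromW : ∀ {x y} → Below x → y ∈ L h → x ∼ w → x ∼ y
      fromW (_ , lx<h) y∈L = upRegular-∼ upReg lx<h w∈L y∈L

      T-trans : ∀ {x y z} → x ∈ T → y ∈ T → z ∈ T → ¬ x ≈ z → x ∼ y → y ∼ z → x ∼ z
      T-trans x∈T y∈T z∈T x≉z x∼y y∼z =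
        ∼-trans x∈T y∈T z∈T (proj₁ x∼y) (proj₁ y∼z) x≉z x∼y y∼z

      Below⇒≉w : ∀ {x} → Below x → ¬ x ≈ w
      Below⇒≉w {x} (_ , lx<h) = level-<⇒≉ (<ᵒ-≤ᵒ-trans (level x) h (level w) lx<h (proj₂ w∈L))

      below-below-top : ∀ {x y z} → Below x → Below y → z ∈ L h → x ∼ y → y ∼ z → x ∼ z
      below-below-top x∈B y∈B z∈L x∼y y∼z =
        fromW x∈B z∈L
          (T-trans (proj₁ x∈B) (proj₁ y∈B) w∈T (Below⇒≉w x∈B) x∼y (toW y∈B z∈L y∼z))

      trans′ : ∀ {x y z} → Below x ⊎ x ∈ L h → Below y ⊎ y ∈ L h → Below z ⊎ z ∈ L h →
               ¬ x ≈ z → x ∼ y → y ∼ z → x ∼ z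
      -- With both ends at level `h`, incomparability comes from the levels alone.
      trans′ (inj₂ x∈L) _ (inj₂ z∈L) x≉z _ _ = level-≈∧≉⇒∼ (L-≈ x∈L z∈L) x≉z
      trans′ (inj₁ x∈B) (inj₁ y∈B) (inj₁ z∈B) x≉z x∼y y∼z =
        T-trans (proj₁ x∈B) (proj₁ y∈B) (proj₁ z∈B) x≉z x∼y y∼z
      -- Here `w` replaces the middle element, and transitivity in `T` is applied to `x`, `w`, `z`.
      trans′ (inj₁ x∈B) (inj₂ y∈L) (inj₁ z∈B) x≉z x∼y y∼z =
        T-trans (proj₁ x∈B) w∈T (proj₁ z∈B) x≉z
          (toW x∈B y∈L x∼y) (∼-sym (toW z∈B y∈L (∼-sym y∼z)))
      trans′ (inj₁ x∈B) (inj₁ y∈B) (inj₂ z∈L) _ x∼y y∼z = below-below-top x∈B y∈B z∈L x∼y y∼z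
      trans′ (inj₂ x∈L) (inj₁ y∈B) (inj₁ z∈B) _ x∼y y∼z =
        ∼-sym (below-below-top z∈B y∈B x∈L (∼-sym y∼z) (∼-sym x∼y))
      -- `y` and `z` share level `h`, so `x ∼ y` passes to `x ∼ z` through `w`.
      trans′ (inj₁ x∈B) (inj₂ y∈L) (inj₂ z∈L) _ x∼y _ = fromW x∈B z∈L (toW x∈B y∈L x∼y)
      trans′ (inj₂ x∈L) (inj₂ y∈L) (inj₁ z∈B) _ _ y∼z =
        ∼-sym (fromW z∈B x∈L (toW z∈B y∈L (∼-sym y∼z)))

    absorb⇒<-level : TrunksAbsorbTopLevel →
                     ∀ {x y z} → level y ≈ᵒ level z → x < y → x < z
    absorb⇒<-level absorb {x} {y} {z} ly≈lz x<y = x≤z , level-<⇒≉ lx<lz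
      where
      lx<lz : level x <ᵒ level z
      lx<lz = <ᵒ-≤ᵒ-trans (level x) (level y) (level z) (level-mono-< x<y) (proj₁ ly≈lz)

      open IsTrunk (absorb ⟪ x , y ⟫ (pair-isTrunk x y) (level y) (pair-highestLevel x<y))

      x≤z : x ≤ z
      x≤z with x ≤? z | z ≈? y
      ... | yes x≤z | _       = x≤z
      -- This case is split off because `z ∼ y` requires `z ≉ y`.
      ... | no _    | yes z≈y = trans (proj₁ x<y) (reflexive (Eq.sym z≈y))
      ... | no x≰z  | no z≉y  = contradiction (proj₁ x<y) (proj₁ (proj₂ x∼y))
        where
        x∼z : x ∼ z
        x∼z = level-<∧≰⇒∼ lx<lz x≰z

        x∼y : x ∼ y
        -- Transitivity along `x`, `z`, `y`: the ends come from the pair, and `z` from the adjoined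
        -- level of `y`.
        x∼y = ∼-trans (inj₁ (lift (inj₁ Eq.refl))) (inj₂ (swap ly≈lz)) (inj₁ (lift (inj₂ Eq.refl)))
                      (proj₁ x∼z) z≉y (proj₂ x<y) x∼z (level-≈∧≉⇒∼ (swap ly≈lz) z≉y)

    absorb⇒upRegular : TrunksAbsorbTopLevel → UpRegular
    absorb⇒upRegular absorb x y z _ ly≈lz =
      mk⇔ (absorb⇒<-level absorb ly≈lz) (absorb⇒<-level absorb (swap ly≈lz))

    -- `T ∪ L h` is a trunk containing `T` and lives in the same universe as `T`, so `maximal`
    -- applies to it.
    maximal⇒⊇L : UpRegular → (T : Pred Carrier (c ⊔ ℓ₁ ⊔ ℓ₂)) → IsMaximalTrunk T →
                 ∀ h → IsHighestLevel T h → L h ⊆ T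
    maximal⇒⊇L upReg T max h highest x∈L =
      maximal (T ∪ L h) (upRegular⇒absorb upReg T isTrunk h highest) inj₁ (inj₂ x∈L)
      where open IsMaximalTrunk max

mainTheorem12 : ∀ {c ℓ₁ ℓ₂} → ExcludedMiddle (c ⊔ ℓ₁ ⊔ ℓ₂) →
    (P : Poset c ℓ₁ ℓ₂) (wf : WellFounded (Order._<_ P)) →
    let open Poset P using (Carrier)
        open WellFoundedOrder P wf
    in
    (UpRegular ⇔
      ((T : Pred Carrier (c ⊔ ℓ₁ ⊔ ℓ₂)) → IsTrunk T →
       ∀ h → IsHighestLevel T h → IsTrunk (T ∪ L h)))
    ×
    (UpRegular →
      (T : Pred Carrier (c ⊔ ℓ₁ ⊔ ℓ₂)) → IsMaximalTrunk T →
       ∀ h → IsHighestLevel T h → L h ⊆ T)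
mainTheorem12 em P wf = mk⇔ upRegular⇒absorb absorb⇒upRegular , maximal⇒⊇L
  where
  open Levels P wf
  open Classical em
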